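{- Let $r\ge 3$, $n\ge d\ge 1$. Whatever families $\mathcal F_1,\dots,\mathcal F_{r-2}$ the Questioner poses in rounds $1,\dots,r-2$, an Adversary can answer them round by round (answers in round $t$ depending only on $\mathcal F_1,\dots,\mathcal F_t$ and earlier answers) in such a way that for every $1\le t\le r-2$ at least one of the following holds: (i) all answers in the first $t$ rounds are "no" and $|G_t|\le n-n_t$; or (ii) $m_t(i)\ge i\,n_t$ for every $1\le i\le d$.
   Context: Setting: $[n]=\{1,\dots,n\}$; in round $t$ the Questioner poses a finite family $\mathcal F_t$ of subsets of $[n]$ and each query is answered "yes" or "no" (here by an Adversary). Notation: $k_t=|\mathcal F_t|$; $\mathcal F_t^Y,\mathcal F_t^N$ are the queries of round $t$ answered yes/no; $G_0=\emptyset$, $G_t=\bigcup\{F:F\in\mathcal F_j^N,\ j\le t\}$; $\mathcal G_t=\{F\setminus G_t:F\in\mathcal F_j^Y,\ j\le t\}$; $n_0=n$, $n_t=\lfloor n_{t-1}/(k_t+1)\rfloor$. For a family $\mathcal F$ of subsets of $[n]$ and $1\le i\le d$, $m(i,\mathcal F)=\min\{|A_1\cup\dots\cup A_i| : A_1,\dots,A_i \text{ pairwise distinct members of } \mathcal F\}$ (minimum over the empty set is $+\infty$), and $m_t(i)=m(i,\mathcal G_t)$. Standing convention: every member of $\mathcal F_t$ is a subset of $[n]\setminus G_{t-1}$. -}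

module Defs where

open import Data.Nat using (ℕ; zero; suc; _+_; _*_; _∸_; _≤_; _/_)
open import Data.Bool using (Bool; true; false; not)
open import Data.List using (List; []; _∷_; _++_; [_]; map; filter; concat; length; foldl; take)
open import Data.List.Relation.Unary.All using (All)
open import Data.List.Relation.Unary.Unique.Propositional using (Unique)
open import Data.List.Membership.Propositional using (_∈_)
open import Data.Product using (_×_; _,_; proj₁; proj₂)
open import Data.Unit using (⊤)
open import Data.Fin.Subset using (Subset; ⋃; _─_; ∁; ∣_∣; _⊆_)
open import Relation.Nullary using (¬_)
open import Relation.Binary.PropositionalEquality using (_≡_)
open import Data.Bool using (T)

-- A query family posed in one round: a list of subsets of [n]
-- (together with a Unique hypothesis it represents a finite set of subsets).
Family : ℕ → Set
Family n = List (Subset n)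

-- A played round: each query together with its answer (true = "yes", false = "no").
Round : ℕ → Set
Round n = List (Subset n × Bool)

-- History of play: the rounds played so far, in chronological order.
History : ℕ → Set
History n = List (Round n)

-- An Adversary strategy: given the history of earlier rounds (families and
-- answers) and the current family 𝓕_t, answer each query F ∈ 𝓕_t.
Adversary : ℕ → Set
Adversary n = History n → Family n → Subset n → Bool

answerRound : ∀ {n} → Adversary n → History n → Family n → Round n
answerRound A past f = map (λ F → F , A past f F) f

playFrom : ∀ {n} → Adversary n → History n → List (Family n) → History n
playFrom A past []       = past
playFrom A past (f ∷ fs) = playFrom A (past ++ [ answerRound A past f ]) fs

play : ∀ {n} → Adversary n → List (Family n) → History n
play A fs = playFrom A [] fs

noQueries : ∀ {n} → History n → List (Subset n)
noQueries h = map proj₁ (filter (λ p → Data.Bool._≟_ (proj₂ p) false) (concat h))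
  where import Data.Bool

yesQueries : ∀ {n} → History n → List (Subset n)
yesQueries h = map proj₁ (filter (λ p → Data.Bool._≟_ (proj₂ p) true) (concat h))
  where import Data.Bool

G : ∀ {n} → History n → Subset n
G h = ⋃ (noQueries h)

-- 𝒢_t = { F ∖ G_t : F answered "yes" so far }  (as a list, possibly with repetitions)
𝒢 : ∀ {n} → History n → List (Subset n)
𝒢 h = map (λ F → F ─ G h) (yesQueries h)

-- n_t : n_0 = n, n_t = ⌊ n_{t-1} / (k_t + 1) ⌋ with k_t = |𝓕_t|
nSeq : ∀ {n} → History n → ℕ
nSeq {n} h = foldl (λ m R → m / suc (length R)) n h

AllNo : ∀ {n} → History n → Set
AllNo h = All (λ p → proj₂ p ≡ false) (concat h)

-- "m(i,𝒢) ≥ x", where m(i,𝒢) = min { |A₁ ∪ … ∪ Aᵢ| : A₁,…,Aᵢ pairwise distinct members of 𝒢 }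
-- (min ∅ = +∞): every choice of i pairwise distinct members has union of size ≥ x.
mGe : ∀ {n} → ℕ → List (Subset n) → ℕ → Set
mGe {n} i 𝒢' x = (As : List (Subset n)) → length As ≡ i → Unique As →
                 All (_∈ 𝒢') As → x ≤ ∣ ⋃ As ∣

-- Legality of the Questioner's families against adversary A (standing convention):
-- each family is a set (no repeated member) and every member of 𝓕_t is a
-- subset of [n] ∖ G_{t-1}.
LegalFrom : ∀ {n} → Adversary n → History n → List (Family n) → Set
LegalFrom A past []       = ⊤
LegalFrom A past (f ∷ fs) =
  Unique f × All (λ F → F ⊆ ∁ (G past)) f × LegalFrom A (past ++ [ answerRound A past f ]) fs

Legal : ∀ {n} → Adversary n → List (Family n) → Set
Legal A fs = LegalFrom A [] fs

RoundGood : ∀ {n} → (d : ℕ) → History n → Set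
RoundGood {n} d h =
  (AllNo h × ∣ G h ∣ ≤ n ∸ nSeq h)
  Data.Sum.⊎
  ((i : ℕ) → 1 ≤ i → i ≤ d → mGe i (𝒢 h) (i * nSeq h))
  where import Data.Sum

-- In round t the Adversary answers "no" exactly to the queries of a set X ⊆ 𝓕_t minimising
--   |⋃X ∖ G_{t-1}| + n_t · |𝓕_t ∖ X|,
-- i.e. every query answered "yes" costs n_t, every newly deleted point costs 1.  Then the
-- family 𝒢_t stays spread: any s distinct members of it cover at least s · n_t points.
-- The new members (yes-answers of round t) pay for themselves, since rejecting them as well
-- would not lower the cost; the old ones lose at most |⋃X ∖ G_{t-1}| ≤ k_t n_t points,
-- which the gap n_{t-1} ≥ (k_t + 1) n_t absorbs.

module Submission where

open import Defs
open import Data.Nat using (ℕ; zero; suc; _+_; _*_; _∸_; _≤_; _/_; z≤n; s≤s)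
open import Data.Nat.Properties
  using (≤-refl; ≤-trans; ≤-reflexive; n≤1+n; +-suc; *-comm; m≤m+n; n≤0⇒n≡0;
         +-mono-≤; +-monoˡ-≤; +-monoʳ-≤; *-monoˡ-≤; *-monoʳ-≤; +-cancelˡ-≤; +-cancelʳ-≤; module ≤-Reasoning)
open import Data.Nat.DivMod using (m/n*n≤m)
open import Data.Nat.Tactic.RingSolver using (solve-∀)
open import Data.Bool using (Bool; true; false; not; _∧_)
import Data.Bool.Properties as Bool
open import Data.Fin using (Fin)
open import Data.Fin.Subset using (Subset; ⊥; _∪_; _─_; ⋃; ∣_∣; inside; outside)
  renaming (_∈_ to _∈ₛ_; _∉_ to _∉ₛ_; _⊆_ to _⊆ₛ_)
open import Data.Fin.Subset.Properties
  using (∣⊥∣≡0; ∉⊥; ⊆-antisym; ∪-assoc; ∪-identityˡ; p⊆q⇒∣p∣≤∣q∣; x∈p∪q⁺; x∈p∪q⁻; p─q⊆p; x∈p∧x∉q⇒x∈p─q;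
         ∣p─q∣≤∣p∣; p─q─r≡p─q∪r)
  renaming (_∈?_ to _∈ₛ?_)
open import Data.List using (List; []; _∷_; _++_; [_]; length; map; filter; concat; take; deduplicate)
import Data.List.Properties as List
open import Data.List.Membership.Propositional using (_∈_)
open import Data.List.Membership.Propositional.Properties
  using (∈-map⁺; ∈-map⁻; ∈-filter⁺; ∈-filter⁻; ∈-++⁺ˡ; ∈-++⁺ʳ; ∈-++⁻; ∈-deduplicate⁺; ∈-deduplicate⁻)
import Data.List.Membership.DecPropositional as DecMembership
open import Data.List.Relation.Unary.Any as Any using (here; there)
open import Data.List.Relation.Unary.All as All using (All; []; _∷_; tabulate)
import Data.List.Relation.Unary.All.Properties as All
open import Data.List.Relation.Unary.AllPairs using (_∷_)
open import Data.List.Relation.Unary.Unique.Propositional using (Unique)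
import Data.List.Relation.Unary.Unique.Propositional.Properties as Unique
import Data.List.Relation.Unary.Unique.DecPropositional.Properties as UniqueDec
open import Data.List.Extrema.Nat using (argmin; f[argmin]≤f[⊤]; f[argmin]≤f[xs]; argmin-all)
open import Data.Vec using ([]; _∷_; here; there)
open import Data.Vec.Properties using (≡-dec)
open import Data.Product using (Σ; _×_; _,_; proj₁; proj₂)
open import Data.Sum using (_⊎_; inj₁; inj₂; [_,_]′)
open import Data.Empty using (⊥-elim)
open import Function using (_∘_; id)
open import Relation.Nullary using (yes; no; does)
open import Relation.Nullary.Decidable using (dec-true)
open import Relation.Unary using (Pred; Decidable)
open import Relation.Unary.Properties using (∁?)
open import Relation.Binary using (DecidableEquality)
open import Relation.Binary.PropositionalEquality
  using (_≡_; _≢_; refl; sym; trans; cong; cong₂; subst; subst₂; module ≡-Reasoning)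

_≟ₛ_ : ∀ {n} → DecidableEquality (Subset n)
_≟ₛ_ = ≡-dec Bool._≟_

x∈p─q⇒x∉q : ∀ {n} {x : Fin n} (p q : Subset n) → x ∈ₛ p ─ q → x ∉ₛ q
x∈p─q⇒x∉q (_ ∷ p) (outside ∷ q) (there x∈) (there x∈q) = x∈p─q⇒x∉q p q x∈ x∈q
x∈p─q⇒x∉q (_ ∷ p) (inside  ∷ q) (there x∈) (there x∈q) = x∈p─q⇒x∉q p q x∈ x∈q

p∪[q─p]≡p∪q : ∀ {n} (p q : Subset n) → p ∪ (q ─ p) ≡ p ∪ q
p∪[q─p]≡p∪q []            []      = refl
p∪[q─p]≡p∪q (inside  ∷ p) (_ ∷ q) = cong (inside ∷_) (p∪[q─p]≡p∪q p q)
p∪[q─p]≡p∪q (outside ∷ p) (x ∷ q) = cong (x ∷_) (p∪[q─p]≡p∪q p q)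

p─q─[r─q]≡p─[q∪r] : ∀ {n} (p q r : Subset n) → p ─ q ─ (r ─ q) ≡ p ─ (q ∪ r)
p─q─[r─q]≡p─[q∪r] p q r = trans (p─q─r≡p─q∪r p q (r ─ q)) (cong (p ─_) (p∪[q─p]≡p∪q q r))

∣p∪q∣≤∣p∣+∣q∣ : ∀ {n} (p q : Subset n) → ∣ p ∪ q ∣ ≤ ∣ p ∣ + ∣ q ∣
∣p∪q∣≤∣p∣+∣q∣ []            []            = z≤n
∣p∪q∣≤∣p∣+∣q∣ (inside  ∷ p) (outside ∷ q) = s≤s (∣p∪q∣≤∣p∣+∣q∣ p q)
∣p∪q∣≤∣p∣+∣q∣ (inside  ∷ p) (inside  ∷ q) =
  s≤s (≤-trans (∣p∪q∣≤∣p∣+∣q∣ p q) (+-monoʳ-≤ ∣ p ∣ (n≤1+n ∣ q ∣)))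
∣p∪q∣≤∣p∣+∣q∣ (outside ∷ p) (inside  ∷ q) =
  subst (suc ∣ p ∪ q ∣ ≤_) (sym (+-suc ∣ p ∣ ∣ q ∣)) (s≤s (∣p∪q∣≤∣p∣+∣q∣ p q))
∣p∪q∣≤∣p∣+∣q∣ (outside ∷ p) (outside ∷ q) = ∣p∪q∣≤∣p∣+∣q∣ p q

module _ {n : ℕ} where

  ∣⊥─p∣≡0 : (p : Subset n) → ∣ ⊥ ─ p ∣ ≡ 0
  ∣⊥─p∣≡0 p = n≤0⇒n≡0 (subst (∣ ⊥ ─ p ∣ ≤_) (∣⊥∣≡0 n) (∣p─q∣≤∣p∣ ⊥ p))

  ─-split : {p q s r : Subset n} → p ⊆ₛ q ∪ s → ∣ p ─ r ∣ ≤ ∣ q ─ r ∣ + ∣ s ─ (r ∪ q) ∣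
  ─-split {p} {q} {s} {r} p⊆q∪s =
    ≤-trans (p⊆q⇒∣p∣≤∣q∣ split) (∣p∪q∣≤∣p∣+∣q∣ (q ─ r) (s ─ (r ∪ q)))
    where
    split : p ─ r ⊆ₛ (q ─ r) ∪ (s ─ (r ∪ q))
    split {x} x∈ with x∉r ← x∈p─q⇒x∉q p r x∈ | x ∈ₛ? q | x∈p∪q⁻ q s (p⊆q∪s (p─q⊆p p r x∈))
    ... | yes x∈q | _      = x∈p∪q⁺ (inj₁ (x∈p∧x∉q⇒x∈p─q x∈q x∉r))
    ... | no  x∉q | inj₁ x∈q = ⊥-elim (x∉q x∈q)
    ... | no  x∉q | inj₂ x∈s =
      x∈p∪q⁺ (inj₂ (x∈p∧x∉q⇒x∈p─q x∈s ([ x∉r , x∉q ]′ ∘ x∈p∪q⁻ r q)))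

  ∈⇒⊆⋃ : {S : Subset n} {L : List (Subset n)} → S ∈ L → S ⊆ₛ ⋃ L
  ∈⇒⊆⋃ (here refl) x∈ = x∈p∪q⁺ (inj₁ x∈)
  ∈⇒⊆⋃ (there S∈)  x∈ = x∈p∪q⁺ (inj₂ (∈⇒⊆⋃ S∈ x∈))

  x∈⋃⁻ : {x : Fin n} (L : List (Subset n)) → x ∈ₛ ⋃ L → Σ (Subset n) λ S → S ∈ L × x ∈ₛ S
  x∈⋃⁻ []      x∈ = ⊥-elim (∉⊥ x∈)
  x∈⋃⁻ (S ∷ L) x∈ with x∈p∪q⁻ S (⋃ L) x∈
  ... | inj₁ x∈S = S , here refl , x∈S
  ... | inj₂ x∈⋃ with T , T∈ , x∈T ← x∈⋃⁻ L x∈⋃ = T , there T∈ , x∈T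

  ⋃-mono : {L L′ : List (Subset n)} → (∀ {S} → S ∈ L → S ∈ L′) → ⋃ L ⊆ₛ ⋃ L′
  ⋃-mono {L} L⊆L′ x∈ with S , S∈ , x∈S ← x∈⋃⁻ L x∈ = ∈⇒⊆⋃ (L⊆L′ S∈) x∈S

  ⋃-++ : (L L′ : List (Subset n)) → ⋃ (L ++ L′) ≡ ⋃ L ∪ ⋃ L′
  ⋃-++ []      L′ = sym (∪-identityˡ (⋃ L′))
  ⋃-++ (S ∷ L) L′ = trans (cong (S ∪_) (⋃-++ L L′)) (sym (∪-assoc S (⋃ L) (⋃ L′)))

module _ {a} {A : Set a} where

  ∈-─ : ∀ {x z : A} {ys} (x∈ys : x ∈ ys) → z ∈ ys → x ≢ z → z ∈ (ys Any.─ x∈ys)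
  ∈-─ (here refl) (here refl) x≢z = ⊥-elim (x≢z refl)
  ∈-─ (here _)    (there z∈)  x≢z = z∈
  ∈-─ (there _)   (here z≡)   x≢z = here z≡
  ∈-─ (there x∈)  (there z∈)  x≢z = there (∈-─ x∈ z∈ x≢z)

  unique-⊆⇒length≤ : ∀ {xs ys : List A} → Unique xs → (∀ {z} → z ∈ xs → z ∈ ys) → length xs ≤ length ys
  unique-⊆⇒length≤ {[]}     _            _      = z≤n
  unique-⊆⇒length≤ {x ∷ xs} {ys} (x∉xs ∷ u) xs⊆ys =
    subst (suc (length xs) ≤_) (sym (List.length-removeAt′ ys (Any.index x∈ys)))
      (s≤s (unique-⊆⇒length≤ u (λ z∈ → ∈-─ x∈ys (xs⊆ys (there z∈)) (All.lookup x∉xs z∈))))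
    where x∈ys = xs⊆ys (here refl)

  unique-⊆-map⇒length≤ : ∀ {b} {B : Set b} {g : B → A} {xs} {ys : List B} →
                         Unique xs → All (_∈ map g ys) xs → length xs ≤ length ys
  unique-⊆-map⇒length≤ {g = g} {ys = ys} u xs⊆ =
    subst (_ ≤_) (List.length-map g ys) (unique-⊆⇒length≤ u (All.lookup xs⊆))

  take-∷ʳ : ∀ t xs (y : A) → take t (xs ++ [ y ]) ≡ take t xs ⊎ take t (xs ++ [ y ]) ≡ xs ++ [ y ]
  take-∷ʳ zero    xs       y = inj₁ refl
  take-∷ʳ (suc t) []       y = inj₂ (cong (y ∷_) (List.take-[] t))
  take-∷ʳ (suc t) (x ∷ xs) y = [ inj₁ ∘ cong (x ∷_) , inj₂ ∘ cong (x ∷_) ]′ (take-∷ʳ t xs y)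

  length-filter+length-filter-∁ : ∀ {p} {P : Pred A p} (P? : Decidable P) xs →
                                  length (filter P? xs) + length (filter (∁? P?) xs) ≡ length xs
  length-filter+length-filter-∁ P? []       = refl
  length-filter+length-filter-∁ P? (x ∷ xs) with P? x
  ... | yes _ = cong suc (length-filter+length-filter-∁ P? xs)
  ... | no  _ = trans (+-suc _ _) (cong suc (length-filter+length-filter-∁ P? xs))

-- Labellings: lists of items each marked accepted (true) or rejected (false)

module _ {a} {A : Set a} where

  accepted rejected : List (A × Bool) → List A
  accepted []               = []
  accepted ((x , true)  ∷ R) = x ∷ accepted R
  accepted ((x , false) ∷ R) = accepted R
  rejected []               = []
  rejected ((x , true)  ∷ R) = rejected R
  rejected ((x , false) ∷ R) = x ∷ rejected R

  acceptAll : List A → List (A × Bool)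
  acceptAll = map (_, true)

  labels-acceptAll : ∀ xs → map proj₁ (acceptAll xs) ≡ xs
  labels-acceptAll []       = refl
  labels-acceptAll (x ∷ xs) = cong (x ∷_) (labels-acceptAll xs)

  accepted-acceptAll : ∀ xs → accepted (acceptAll xs) ≡ xs
  accepted-acceptAll []       = refl
  accepted-acceptAll (x ∷ xs) = cong (x ∷_) (accepted-acceptAll xs)

  rejected-acceptAll : ∀ xs → rejected (acceptAll xs) ≡ []
  rejected-acceptAll []       = refl
  rejected-acceptAll (x ∷ xs) = rejected-acceptAll xs

  labelled⇒accepted⊎rejected : ∀ {x} R → x ∈ map proj₁ R → x ∈ accepted R ⊎ x ∈ rejected R
  labelled⇒accepted⊎rejected ((y , true)  ∷ R) (here refl) = inj₁ (here refl)
  labelled⇒accepted⊎rejected ((y , false) ∷ R) (here refl) = inj₂ (here refl)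
  labelled⇒accepted⊎rejected ((y , true)  ∷ R) (there x∈) =
    [ inj₁ ∘ there , inj₂ ]′ (labelled⇒accepted⊎rejected R x∈)
  labelled⇒accepted⊎rejected ((y , false) ∷ R) (there x∈) =
    [ inj₁ , inj₂ ∘ there ]′ (labelled⇒accepted⊎rejected R x∈)

  rejected⇒labelled : ∀ {x} R → x ∈ rejected R → x ∈ map proj₁ R
  rejected⇒labelled ((y , true)  ∷ R) x∈         = there (rejected⇒labelled R x∈)
  rejected⇒labelled ((y , false) ∷ R) (here refl) = here refl
  rejected⇒labelled ((y , false) ∷ R) (there x∈) = there (rejected⇒labelled R x∈)

  module _ {p} {P : Pred A p} (P? : Decidable P) where

    rejectAlso : List (A × Bool) → List (A × Bool)
    rejectAlso []            = []
    rejectAlso ((x , b) ∷ R) = (x , b ∧ not (does (P? x))) ∷ rejectAlso R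

    labels-rejectAlso : ∀ R → map proj₁ (rejectAlso R) ≡ map proj₁ R
    labels-rejectAlso []            = refl
    labels-rejectAlso ((x , b) ∷ R) = cong (x ∷_) (labels-rejectAlso R)

    accepted-rejectAlso : ∀ R → accepted (rejectAlso R) ≡ filter (∁? P?) (accepted R)
    accepted-rejectAlso []                = refl
    accepted-rejectAlso ((x , false) ∷ R) = accepted-rejectAlso R
    accepted-rejectAlso ((x , true)  ∷ R) with P? x
    ... | yes _ = accepted-rejectAlso R
    ... | no  _ = cong (x ∷_) (accepted-rejectAlso R)

    rejected-rejectAlso : ∀ {y} R → y ∈ rejected (rejectAlso R) → y ∈ rejected R ⊎ y ∈ filter P? (accepted R)
    rejected-rejectAlso ((x , false) ∷ R) (here refl) = inj₁ (here refl)
    rejected-rejectAlso ((x , false) ∷ R) (there y∈) =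
      [ inj₁ ∘ there , inj₂ ]′ (rejected-rejectAlso R y∈)
    rejected-rejectAlso ((x , true) ∷ R) y∈ with P? x
    rejected-rejectAlso ((x , true) ∷ R) (here refl) | yes _ = inj₂ (here refl)
    rejected-rejectAlso ((x , true) ∷ R) (there y∈) | yes _ =
      [ inj₁ , inj₂ ∘ there ]′ (rejected-rejectAlso R y∈)
    rejected-rejectAlso ((x , true) ∷ R) y∈          | no  _ = rejected-rejectAlso R y∈

  labellings : List A → List (List (A × Bool))
  labellings []       = [ [] ]
  labellings (x ∷ xs) = map ((x , true) ∷_) (labellings xs) ++ map ((x , false) ∷_) (labellings xs)

  labellings-labels : ∀ xs → All (λ R → map proj₁ R ≡ xs) (labellings xs)
  labellings-labels []       = refl ∷ []
  labellings-labels (x ∷ xs) =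
    All.++⁺ (All.map⁺ (All.map (cong (x ∷_)) (labellings-labels xs)))
            (All.map⁺ (All.map (cong (x ∷_)) (labellings-labels xs)))

  ∈-labellings : ∀ {xs} R → map proj₁ R ≡ xs → R ∈ labellings xs
  ∈-labellings []                refl = here refl
  ∈-labellings ((x , true)  ∷ R) refl = ∈-++⁺ˡ (∈-map⁺ ((x , true) ∷_) (∈-labellings R refl))
  ∈-labellings ((x , false) ∷ R) refl = ∈-++⁺ʳ _ (∈-map⁺ ((x , false) ∷_) (∈-labellings R refl))

-- The cost-optimal labelling of a round

module _ {n : ℕ} where

  -- G₀ : the points deleted so far, b : the price of a "yes" answer.
  cost : Subset n → ℕ → List (Subset n × Bool) → ℕ
  cost G₀ b R = ∣ ⋃ (rejected R) ─ G₀ ∣ + b * length (accepted R)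

  record IsOptimal (G₀ : Subset n) (b : ℕ) (f : List (Subset n)) (R : List (Subset n × Bool)) : Set where
    field
      labels  : map proj₁ R ≡ f
      minimal : ∀ R′ → map proj₁ R′ ≡ f → cost G₀ b R ≤ cost G₀ b R′

  -- Kept opaque: unfolding the argmin over all 2^|f| labellings makes unification blow up.
  opaque
    optimal : Subset n → ℕ → List (Subset n) → List (Subset n × Bool)
    optimal G₀ b f = argmin (cost G₀ b) (acceptAll f) (labellings f)

    optimal-isOptimal : ∀ G₀ b f → IsOptimal G₀ b f (optimal G₀ b f)
    optimal-isOptimal G₀ b f = record
      { labels  = argmin-all (cost G₀ b) (labels-acceptAll f) (labellings-labels f)
      ; minimal = λ R′ R′-labels-f →
          All.lookup (f[argmin]≤f[xs] (acceptAll f) (labellings f)) (∈-labellings R′ R′-labels-f)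
      }

  module _ {G₀ : Subset n} {b : ℕ} {f : List (Subset n)} {R} (R-optimal : IsOptimal G₀ b f R) where
    open IsOptimal R-optimal

    optimal-cost≤ : cost G₀ b R ≤ b * length f
    optimal-cost≤ = subst (cost G₀ b R ≤_) cost-acceptAll (minimal (acceptAll f) (labels-acceptAll f))
      where
      cost-acceptAll : cost G₀ b (acceptAll f) ≡ b * length f
      cost-acceptAll rewrite rejected-acceptAll f | accepted-acceptAll f | ∣⊥─p∣≡0 G₀ = refl

    -- Rejecting the accepted members Y as well would delete at most |⋃Y ∖ (G₀ ∪ ⋃X)| further
    -- points and save b per member of Y; by optimality this cannot pay.
    optimal-exchange : ∀ {p} {P : Pred (Subset n) p} (P? : Decidable P) →
      b * length (filter P? (accepted R)) ≤ ∣ ⋃ (filter P? (accepted R)) ─ (G₀ ∪ ⋃ (rejected R)) ∣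
    optimal-exchange P? = cancel u w b (length Y) (length Z) (begin
        u + b * (length Y + length Z)          ≡⟨ cong (λ m → u + b * m) (length-filter+length-filter-∁ P? (accepted R)) ⟩
        cost G₀ b R                            ≤⟨ minimal R′ (trans (labels-rejectAlso P? R) labels) ⟩
        ∣ ⋃ (rejected R′) ─ G₀ ∣ + b * length (accepted R′)
          ≤⟨ +-mono-≤ (─-split ⋃X′⊆⋃X∪⋃Y) (≤-reflexive (cong (λ L → b * length L) (accepted-rejectAlso P? R))) ⟩
        u + w + b * length Z                   ∎)
      where
      open ≤-Reasoning
      R′ = rejectAlso P? R
      X = rejected R
      Y = filter P? (accepted R)
      Z = filter (∁? P?) (accepted R)
      u = ∣ ⋃ X ─ G₀ ∣
      w = ∣ ⋃ Y ─ (G₀ ∪ ⋃ X) ∣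

      ⋃X′⊆⋃X∪⋃Y : ⋃ (rejected R′) ⊆ₛ ⋃ X ∪ ⋃ Y
      ⋃X′⊆⋃X∪⋃Y = subst (⋃ (rejected R′) ⊆ₛ_) (⋃-++ X Y)
        (⋃-mono ([ ∈-++⁺ˡ , ∈-++⁺ʳ X ]′ ∘ rejected-rejectAlso P? R))

      cancel : ∀ u w b y z → u + b * (y + z) ≤ u + w + b * z → b * y ≤ w
      cancel u w b y z le = +-cancelˡ-≤ (u + b * z) (b * y) w
        (subst₂ _≤_ (e₁ u b y z) (e₂ u w b z) le)
        where
        e₁ : ∀ u b y z → u + b * (y + z) ≡ u + b * z + b * y
        e₁ = solve-∀
        e₂ : ∀ u w b z → u + w + b * z ≡ u + b * z + w
        e₂ = solve-∀

module _ {n : ℕ} where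
  open DecMembership (_≟ₛ_ {n}) using (_∈?_)

  Spread : ℕ → List (Subset n) → Set
  Spread a 𝒜 = ∀ As → Unique As → All (_∈ 𝒜) As → length As * a ≤ ∣ ⋃ As ∣

  spread-[] : ∀ a → Spread a []
  spread-[] a []      _ _        = z≤n
  spread-[] a (_ ∷ _) _ (() ∷ _)

  Spread⇒mGe : ∀ {a 𝒜} → Spread a 𝒜 → ∀ i → mGe i 𝒜 (i * a)
  Spread⇒mGe spread i As refl = spread As

  spread-─ : ∀ {a 𝒜} → Spread a 𝒜 → ∀ D {As} → Unique As → All (_∈ map (_─ D) 𝒜) As →
             length As * a ≤ ∣ ⋃ As ∣ + ∣ D ∣
  spread-─ {a} {𝒜} spread D {As} uniqueAs As⊆ = begin
      length As * a    ≤⟨ *-monoˡ-≤ a (unique-⊆-map⇒length≤ uniqueAs (All.tabulate hit)) ⟩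
      length Bs * a    ≤⟨ spread Bs (UniqueDec.deduplicate-! _≟ₛ_ _) Bs⊆𝒜 ⟩
      ∣ ⋃ Bs ∣         ≤⟨ p⊆q⇒∣p∣≤∣q∣ ⋃Bs⊆⋃As∪D ⟩
      ∣ ⋃ As ∪ D ∣     ≤⟨ ∣p∪q∣≤∣p∣+∣q∣ (⋃ As) D ⟩
      ∣ ⋃ As ∣ + ∣ D ∣ ∎
    where
    open ≤-Reasoning
    Hits? : Decidable (λ M → M ─ D ∈ As)
    Hits? M = M ─ D ∈? As

    Bs = deduplicate _≟ₛ_ (filter Hits? 𝒜)

    Bs⊆𝒜 : All (_∈ 𝒜) Bs
    Bs⊆𝒜 = tabulate (proj₁ ∘ ∈-filter⁻ Hits? {xs = 𝒜} ∘ ∈-deduplicate⁻ _≟ₛ_ (filter Hits? 𝒜))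

    hit : ∀ {c} → c ∈ As → c ∈ map (_─ D) Bs
    hit c∈ with M , M∈ , refl ← ∈-map⁻ (_─ D) (All.lookup As⊆ c∈) =
      ∈-map⁺ (_─ D) (∈-deduplicate⁺ _≟ₛ_ (∈-filter⁺ Hits? M∈ c∈))

    ⋃Bs⊆⋃As∪D : ⋃ Bs ⊆ₛ ⋃ As ∪ D
    ⋃Bs⊆⋃As∪D {x} x∈ with x ∈ₛ? D
    ... | yes x∈D = x∈p∪q⁺ (inj₂ x∈D)
    ... | no  x∉D with M , M∈ , x∈M ← x∈⋃⁻ Bs x∈ =
      x∈p∪q⁺ (inj₁ (∈⇒⊆⋃ M─D∈As (x∈p∧x∉q⇒x∈p─q x∈M x∉D)))
      where M─D∈As = proj₂ (∈-filter⁻ Hits? {xs = 𝒜} (∈-deduplicate⁻ _≟ₛ_ (filter Hits? 𝒜) M∈))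

  optimal⇒accepted-spread : ∀ {G₀ b f R} → IsOptimal G₀ b f R →
                            Spread b (map (_─ (G₀ ∪ ⋃ (rejected R))) (accepted R))
  optimal⇒accepted-spread {G₀} {b} {f} {R} R-optimal As uniqueAs As⊆ = begin
      length As * b   ≡⟨ *-comm (length As) b ⟩
      b * length As   ≤⟨ *-monoʳ-≤ b (unique-⊆-map⇒length≤ uniqueAs (All.tabulate hit)) ⟩
      b * length Y    ≤⟨ optimal-exchange R-optimal Hits? ⟩
      ∣ ⋃ Y ─ G₁ ∣    ≤⟨ p⊆q⇒∣p∣≤∣q∣ ⋃Y─G₁⊆⋃As ⟩
      ∣ ⋃ As ∣        ∎
    where
    open ≤-Reasoning
    G₁ = G₀ ∪ ⋃ (rejected R)
    Hits? : Decidable (λ F → F ─ G₁ ∈ As)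
    Hits? F = F ─ G₁ ∈? As
    Y = filter Hits? (accepted R)

    hit : ∀ {c} → c ∈ As → c ∈ map (_─ G₁) Y
    hit c∈ with F , F∈ , refl ← ∈-map⁻ (_─ G₁) (All.lookup As⊆ c∈) =
      ∈-map⁺ (_─ G₁) (∈-filter⁺ Hits? F∈ c∈)

    ⋃Y─G₁⊆⋃As : ⋃ Y ─ G₁ ⊆ₛ ⋃ As
    ⋃Y─G₁⊆⋃As x∈ with F , F∈ , x∈F ← x∈⋃⁻ Y (p─q⊆p _ G₁ x∈) =
      ∈⇒⊆⋃ (proj₂ (∈-filter⁻ Hits? {xs = accepted R} F∈))
           (x∈p∧x∉q⇒x∈p─q x∈F (x∈p─q⇒x∉q _ G₁ x∈))

split-spread-arith : ∀ {a b k u v s j} → b * suc k ≤ a → s * a ≤ v + u → j * b ≤ v →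
                     u + j * b ≤ b * k → (s + j) * b ≤ v
split-spread-arith {s = zero} _ _ jb≤v _ = jb≤v
split-spread-arith {a} {b} {k} {u} {v} {suc s} {j} b[k+1]≤a sa≤v+u _ u+jb≤bk =
  +-cancelʳ-≤ (b * k) _ _ (+-cancelʳ-≤ u _ _ (begin
    (suc s + j) * b + b * k + u              ≤⟨ m≤m+n _ (s * b * k) ⟩
    (suc s + j) * b + b * k + u + s * b * k  ≡⟨ e₁ s j b k u ⟩
    suc s * (b * suc k) + (u + j * b)        ≤⟨ +-mono-≤ (≤-trans (*-monoʳ-≤ (suc s) b[k+1]≤a) sa≤v+u) u+jb≤bk ⟩
    v + u + b * k                            ≡⟨ e₂ v u b k ⟩
    v + b * k + u                            ∎))
  where
  open ≤-Reasoning
  e₁ : ∀ s j b k u → (suc s + j) * b + b * k + u + s * b * k ≡ suc s * (b * suc k) + (u + j * b)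
  e₁ = solve-∀
  e₂ : ∀ v u b k → v + u + b * k ≡ v + b * k + u
  e₂ = solve-∀

-- The Adversary

module _ {n : ℕ} where
  open DecMembership (_≟ₛ_ {n}) using (_∈?_)

  price : History n → Family n → ℕ
  price h f = nSeq h / suc (length f)

  chosen : History n → Family n → Round n
  chosen h f = optimal (G h) (price h f) f

  chosen-optimal : ∀ h f → IsOptimal (G h) (price h f) f (chosen h f)
  chosen-optimal h f = optimal-isOptimal (G h) (price h f) f

  adversary : Adversary n
  adversary h f F = not (does (F ∈? rejected (chosen h f)))

  answered : Bool → History n → List (Subset n)
  answered b h = map proj₁ (filter (λ p → proj₂ p Bool.≟ b) (concat h))

  answered-++ : ∀ b h h′ → answered b (h ++ h′) ≡ answered b h ++ answered b h′
  answered-++ b h h′ = begin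
      map proj₁ (filter P? (concat (h ++ h′)))
        ≡⟨ cong (map proj₁ ∘ filter P?) (List.concat-++ h h′) ⟨
      map proj₁ (filter P? (concat h ++ concat h′))
        ≡⟨ cong (map proj₁) (List.filter-++ P? (concat h) (concat h′)) ⟩
      map proj₁ (filter P? (concat h) ++ filter P? (concat h′))
        ≡⟨ List.map-++ proj₁ (filter P? (concat h)) (filter P? (concat h′)) ⟩
      answered b h ++ answered b h′
        ∎
    where
    open ≡-Reasoning
    P? = λ (p : Subset n × Bool) → proj₂ p Bool.≟ b

  module _ (A : Adversary n) (h : History n) (f : Family n) {b : Bool} {Q : Subset n} where

    ∈-answered-round⁻ : Q ∈ answered b [ answerRound A h f ] → Q ∈ f × A h f Q ≡ b
    ∈-answered-round⁻ Q∈
      with p , p∈ , refl ← ∈-map⁻ proj₁ Q∈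
      with p∈r , p-answered-b ← ∈-filter⁻ (λ p → proj₂ p Bool.≟ b) {xs = answerRound A h f ++ []} p∈
      with F , F∈ , refl ← ∈-map⁻ (λ F → F , A h f F) (subst (p ∈_) (List.++-identityʳ _) p∈r) =
      F∈ , p-answered-b

    ∈-answered-round⁺ : Q ∈ f → A h f Q ≡ b → Q ∈ answered b [ answerRound A h f ]
    ∈-answered-round⁺ Q∈ AQ≡b = ∈-map⁺ proj₁ (∈-filter⁺ (λ p → proj₂ p Bool.≟ b)
      (∈-++⁺ˡ (∈-map⁺ (λ F → F , A h f F) Q∈)) AQ≡b)

  nSeq-step : ∀ A h f → nSeq (h ++ [ answerRound A h f ]) ≡ price h f
  nSeq-step A h f = trans (List.foldl-++ (λ m R → m / suc (length R)) n h [ answerRound A h f ])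
                          (cong (λ k → nSeq h / suc k) (List.length-map _ f))

  module _ (h : History n) (f : Family n) {Q : Subset n} where

    adversary≡false⇒rejected : adversary h f Q ≡ false → Q ∈ rejected (chosen h f)
    adversary≡false⇒rejected _  with Q ∈? rejected (chosen h f)
    adversary≡false⇒rejected _  | yes Q∈ = Q∈
    adversary≡false⇒rejected () | no  _

    rejected⇒adversary≡false : Q ∈ rejected (chosen h f) → adversary h f Q ≡ false
    rejected⇒adversary≡false Q∈ = cong not (dec-true (Q ∈? rejected (chosen h f)) Q∈)

    adversary≡true⇒accepted : Q ∈ f → adversary h f Q ≡ true → Q ∈ accepted (chosen h f)
    adversary≡true⇒accepted Q∈f Q-accepted
      with labelled⇒accepted⊎rejected (chosen h f) (subst (Q ∈_) (sym (IsOptimal.labels (chosen-optimal h f))) Q∈f)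
    ... | inj₁ Q∈ = Q∈
    ... | inj₂ Q∈ with () ← trans (sym Q-accepted) (rejected⇒adversary≡false Q∈)

  module _ (h : History n) (f : Family n) where
    private
      h′ = h ++ [ answerRound adversary h f ]
      X = rejected (chosen h f)

    G-step : G h′ ≡ G h ∪ ⋃ X
    G-step = begin
        ⋃ (answered false h′)                          ≡⟨ cong ⋃ (answered-++ false h _) ⟩
        ⋃ (answered false h ++ answered false [ r ])   ≡⟨ ⋃-++ (answered false h) _ ⟩
        G h ∪ ⋃ (answered false [ r ])                 ≡⟨ cong (G h ∪_) (⊆-antisym (⋃-mono no⇒X) (⋃-mono X⇒no)) ⟩
        G h ∪ ⋃ X                                      ∎
      where
      open ≡-Reasoning
      r = answerRound adversary h f
      no⇒X : ∀ {Q} → Q ∈ answered false [ r ] → Q ∈ X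
      no⇒X = adversary≡false⇒rejected h f ∘ proj₂ ∘ ∈-answered-round⁻ adversary h f
      X⇒no : ∀ {Q} → Q ∈ X → Q ∈ answered false [ r ]
      X⇒no Q∈ = ∈-answered-round⁺ adversary h f
        (subst (_ ∈_) (IsOptimal.labels (chosen-optimal h f)) (rejected⇒labelled _ Q∈))
        (rejected⇒adversary≡false h f Q∈)

    𝒢-step⁻ : ∀ {c} → c ∈ 𝒢 h′ →
              c ∈ map (_─ (⋃ X ─ G h)) (𝒢 h) ⊎ c ∈ map (_─ (G h ∪ ⋃ X)) (accepted (chosen h f))
    𝒢-step⁻ c∈ with Q , Q∈ , refl ← ∈-map⁻ (_─ G h′) c∈ rewrite G-step
      with ∈-++⁻ (answered true h) (subst (Q ∈_) (answered-++ true h _) Q∈)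
    ... | inj₁ Q-old = inj₁ (subst (_∈ map (_─ (⋃ X ─ G h)) (𝒢 h)) (p─q─[r─q]≡p─[q∪r] Q (G h) (⋃ X))
                              (∈-map⁺ (_─ (⋃ X ─ G h)) (∈-map⁺ (_─ G h) Q-old)))
    ... | inj₂ Q-new with Q∈f , Q-accepted ← ∈-answered-round⁻ adversary h f Q-new =
      inj₂ (∈-map⁺ (_─ (G h ∪ ⋃ X)) (adversary≡true⇒accepted h f Q∈f Q-accepted))

  SpreadAt : History n → Set
  SpreadAt h = Spread (nSeq h) (𝒢 h)

  spread-step : ∀ h f → SpreadAt h → SpreadAt (h ++ [ answerRound adversary h f ])
  spread-step h f spread As uniqueAs As⊆𝒢 = begin
      length As * nSeq (h ++ [ answerRound adversary h f ])
        ≡⟨ cong₂ _*_ (sym (length-filter+length-filter-∁ Old? As)) (nSeq-step adversary h f) ⟩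
      (length Aold + length Anew) * b
        ≤⟨ split-spread-arith {a} {b} {length f} {∣ U ∣} {∣ ⋃ As ∣} {length Aold} b[k+1]≤a old new budget ⟩
      ∣ ⋃ As ∣ ∎
    where
    open ≤-Reasoning
    R = chosen h f
    X = rejected R
    a = nSeq h
    b = price h f
    U = ⋃ X ─ G h

    Old? : Decidable (_∈ map (_─ U) (𝒢 h))
    Old? c = c ∈? map (_─ U) (𝒢 h)
    Aold = filter Old? As
    Anew = filter (∁? Old?) As

    Anew⊆ : All (_∈ map (_─ (G h ∪ ⋃ X)) (accepted R)) Anew
    Anew⊆ = All.tabulate λ c∈ → let c∈As , not-old = ∈-filter⁻ (∁? Old?) {xs = As} c∈ in
      [ ⊥-elim ∘ not-old , id ]′ (𝒢-step⁻ h f (All.lookup As⊆𝒢 c∈As))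

    ⋃-filter⊆⋃ : ∀ {p} {P : Pred (Subset n) p} (P? : Decidable P) → ⋃ (filter P? As) ⊆ₛ ⋃ As
    ⋃-filter⊆⋃ P? = ⋃-mono (proj₁ ∘ ∈-filter⁻ P? {xs = As})

    old : length Aold * a ≤ ∣ ⋃ As ∣ + ∣ U ∣
    old = ≤-trans
      (spread-─ spread U (Unique.filter⁺ Old? uniqueAs) (All.tabulate (proj₂ ∘ ∈-filter⁻ Old? {xs = As})))
      (+-monoˡ-≤ ∣ U ∣ (p⊆q⇒∣p∣≤∣q∣ (⋃-filter⊆⋃ Old?)))

    new : length Anew * b ≤ ∣ ⋃ As ∣
    new = ≤-trans (optimal⇒accepted-spread (chosen-optimal h f) Anew (Unique.filter⁺ (∁? Old?) uniqueAs) Anew⊆)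
                  (p⊆q⇒∣p∣≤∣q∣ (⋃-filter⊆⋃ (∁? Old?)))

    budget : ∣ U ∣ + length Anew * b ≤ b * length f
    budget = ≤-trans
      (+-monoʳ-≤ ∣ U ∣ (subst (_≤ b * length (accepted R)) (*-comm b (length Anew))
        (*-monoʳ-≤ b (unique-⊆-map⇒length≤ (Unique.filter⁺ (∁? Old?) uniqueAs) Anew⊆))))
      (optimal-cost≤ (chosen-optimal h f))

    b[k+1]≤a : b * suc (length f) ≤ a
    b[k+1]≤a = m/n*n≤m a (suc (length f))

  PrefixesSpread : History n → Set
  PrefixesSpread h = ∀ t → SpreadAt (take t h)

  prefixesSpread-[] : PrefixesSpread []
  prefixesSpread-[] t = subst SpreadAt (sym (List.take-[] t)) (spread-[] n)

  prefixesSpread-step : ∀ h f → PrefixesSpread h → PrefixesSpread (h ++ [ answerRound adversary h f ])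
  prefixesSpread-step h f spread t with take-∷ʳ t h (answerRound adversary h f)
  ... | inj₁ e = subst SpreadAt (sym e) (spread t)
  ... | inj₂ e = subst SpreadAt (sym e)
    (spread-step h f (subst SpreadAt (List.take-all (length h) h ≤-refl) (spread (length h))))

  prefixesSpread-playFrom : ∀ fs h → PrefixesSpread h → PrefixesSpread (playFrom adversary h fs)
  prefixesSpread-playFrom []       h spread = spread
  prefixesSpread-playFrom (f ∷ fs) h spread = prefixesSpread-playFrom fs _ (prefixesSpread-step h f spread)

-- Alternative (ii) holds in every round and for every i.
lemma2p3 : (r n d : ℕ) → 3 ≤ r → d ≤ n → 1 ≤ d →
    Σ (Adversary n) λ A →
      (fs : List (Family n)) → length fs ≡ r ∸ 2 → Legal A fs →
      (t : ℕ) → 1 ≤ t → t ≤ r ∸ 2 → RoundGood d (take t (play A fs))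
lemma2p3 r n d _ _ _ = adversary , λ fs _ _ t _ _ →
  inj₂ λ i _ _ → Spread⇒mGe (prefixesSpread-playFrom fs [] prefixesSpread-[] t) i
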